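{- Let $n \geq 6$. Consider a position of $n$-Sim in which the coloured edges are exactly the edges of a drawn $K_5$ on some five of the vertices with one red edge removed (that is, left uncoloured), so that there are five green edges and four red edges, all other edges of the board are uncoloured, and it is PII's turn to move. Then this position is a PII win.
   Context: The game $n$-Sim: the board is the complete graph on $n$ vertices. Two players, PI and PII, alternately colour one previously uncoloured edge, PI moving first; PI colours edges green and PII colours edges red. The first player to complete a triangle all of whose edges are in his own colour loses (the game ends immediately). If all edges are coloured with no monochromatic triangle, the game is a draw (this cannot happen for $n\ge 6$). A position is a partial colouring of the edges by green and red containing no monochromatic triangle. The player to move is determined by the edge counts: PI moves if the numbers of green and red edges are equal, and PII moves if there is exactly one more green edge than red. A position is a "PII win" (respectively "PI win") if PII (respectively PI) has a winning strategy when play continues from that position. A "drawn $K_5$" on a set of five vertices is a colouring of all ten edges among them in which the five green edges form a 5-cycle and the five red edges form the complementary 5-cycle (this is the unique colouring of $K_5$ in two colours without a monochromatic triangle, up to isomorphism). -}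

module Defs where

open import Data.Bool using (if_then_else_)
open import Data.Fin using (Fin; toℕ; _<?_; _≟_)
open import Data.List using (allFin; cartesianProduct; filter; length)
open import Data.Maybe using (Maybe; just; nothing)
import Data.Maybe.Properties as Maybe
open import Data.Nat using (ℕ; suc)
open import Data.Nat.DivMod using (_mod_)
open import Data.Product using (Σ; ∃-syntax; _×_; _,_; proj₁; proj₂)
open import Data.Sum using (_⊎_; inj₁; inj₂)
open import Function.Bundles using (mk⇔)
open import Function.Definitions using (Injective)
open import Relation.Binary.Definitions using (DecidableEquality)
open import Relation.Binary.PropositionalEquality
  using (_≡_; _≢_; refl; sym; trans; cong; cong₂)
open import Relation.Nullary using (¬_; Dec; yes; no; does)
open import Relation.Nullary.Decidable using (_×-dec_; _⊎-dec_; does-⇔; dec-false)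

data Colour : Set where
  green red : Colour

_≟ᶜ_ : DecidableEquality Colour
green ≟ᶜ green = yes refl
green ≟ᶜ red   = no λ ()
red   ≟ᶜ green = no λ ()
red   ≟ᶜ red   = yes refl

data Player : Set where
  PI PII : Player

opponent : Player → Player
opponent PI  = PII
opponent PII = PI

colourOf : Player → Colour
colourOf PI  = green
colourOf PII = red

-- Edges are unordered: an Edge and the one with its ends swapped denote the
-- same edge, and everything below treats them alike.
record Edge (n : ℕ) : Set where
  constructor edge
  field
    end₁ end₂ : Fin n
    distinct  : end₁ ≢ end₂

open Edge public

record Colouring (n : ℕ) : Set where
  field
    colour    : Fin n → Fin n → Maybe Colour
    symmetric : ∀ i j → colour i j ≡ colour j i
    loopless  : ∀ i → colour i i ≡ nothing

open Colouring public

Joins : ∀ {n} → Edge n → Fin n → Fin n → Set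
Joins e i j = (i ≡ end₁ e × j ≡ end₂ e) ⊎ (i ≡ end₂ e × j ≡ end₁ e)

joins? : ∀ {n} (e : Edge n) (i j : Fin n) → Dec (Joins e i j)
joins? e i j = ((i ≟ end₁ e) ×-dec (j ≟ end₂ e)) ⊎-dec ((i ≟ end₂ e) ×-dec (j ≟ end₁ e))

_[_≔_] : ∀ {n} → Colouring n → Edge n → Maybe Colour → Colouring n
_[_≔_] {n} c e m = record
  { colour = new ; symmetric = new-symmetric ; loopless = new-loopless }
  where
  new : Fin n → Fin n → Maybe Colour
  new i j = if does (joins? e i j) then m else colour c i j

  joins-swap : ∀ {i j} → Joins e i j → Joins e j i
  joins-swap (inj₁ (p , q)) = inj₂ (q , p)
  joins-swap (inj₂ (p , q)) = inj₁ (q , p)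

  new-symmetric : ∀ i j → new i j ≡ new j i
  new-symmetric i j = cong₂ (λ b x → if b then m else x)
    (does-⇔ (mk⇔ joins-swap joins-swap) (joins? e i j) (joins? e j i))
    (symmetric c i j)

  not-loop : ∀ i → ¬ Joins e i i
  not-loop i (inj₁ (p , q)) = distinct e (trans (sym p) q)
  not-loop i (inj₂ (p , q)) = distinct e (trans (sym q) p)

  new-loopless : ∀ i → new i i ≡ nothing
  new-loopless i = trans
    (cong (λ b → if b then m else colour c i i) (dec-false (joins? e i i) (not-loop i)))
    (loopless c i)

-- The three vertices are automatically distinct, because c is loopless.
MonoTriangle : ∀ {n} → Colour → Colouring n → Set
MonoTriangle k c = ∃[ x ] ∃[ y ] ∃[ z ]
  (colour c x y ≡ just k × colour c y z ≡ just k × colour c x z ≡ just k)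

TriangleFree : ∀ {n} → Colouring n → Set
TriangleFree c = ∀ k → ¬ MonoTriangle k c

edgeCount : ∀ {n} → Colour → Colouring n → ℕ
edgeCount {n} k c = length (filter
  (λ ij → (proj₁ ij <? proj₂ ij) ×-dec Maybe.≡-dec _≟ᶜ_ (colour c (proj₁ ij) (proj₂ ij)) (just k))
  (cartesianProduct (allFin n) (allFin n)))

record Position (n : ℕ) : Set where
  field
    colouring    : Colouring n
    triangleFree : TriangleFree colouring
    balance      : edgeCount green colouring ≡ edgeCount red colouring
                 ⊎ edgeCount green colouring ≡ suc (edgeCount red colouring)

  toMove : Player
  toMove with balance
  ... | inj₁ _ = PI
  ... | inj₂ _ = PII

open Position public

Move : ∀ {n} → Colouring n → Set
Move {n} c = Σ (Edge n) λ e → colour c (end₁ e) (end₂ e) ≡ nothing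

play : ∀ {n} → Player → (c : Colouring n) → Move c → Colouring n
play P c (e , _) = c [ e ≔ just (colourOf P) ]

data Result : Set where
  wonBy : Player → Result
  draw  : Result

data Ended {n} (c : Colouring n) : Result → Set where
  triangle : ∀ P → MonoTriangle (colourOf P) c → Ended c (wonBy (opponent P))
  full     : TriangleFree c → ¬ Move c → Ended c draw

Ongoing : ∀ {n} → Colouring n → Set
Ongoing c = TriangleFree c × Move c

-- Strategy W P c: a (possibly history-dependent) strategy of W for the rest
-- of the game when the colouring is c and P is the player to move.
data Strategy {n} (W : Player) : Player → Colouring n → Set where
  stop    : ∀ {P c r} → Ended c r → Strategy W P c
  choose  : ∀ {c} → Ongoing c →
            (m : Move c) → Strategy W (opponent W) (play W c m) →
            Strategy W W c
  respond : ∀ {c} → Ongoing c →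
            ((m : Move c) → Strategy W W (play (opponent W) c m)) →
            Strategy W (opponent W) c

-- Play s r: some complete play in which W follows s ends with result r.
data Play {n} {W : Player} : ∀ {P} {c : Colouring n} → Strategy W P c → Result → Set where
  stop    : ∀ {P c r} {end : Ended c r} → Play (stop {P = P} end) r
  choose  : ∀ {c r} {on : Ongoing c} {m : Move c}
            {s : Strategy W (opponent W) (play W c m)} →
            Play s r → Play (choose {c = c} on m s) r
  respond : ∀ {c r} {on : Ongoing c}
            {s : (m : Move c) → Strategy W W (play (opponent W) c m)} →
            (m : Move c) → Play (s m) r → Play (respond {c = c} on s) r

Winning : ∀ {n} {W P : Player} {c : Colouring n} → Strategy W P c → Set
Winning {W = W} s = ∀ {r} → Play s r → r ≡ wonBy W

_IsWinFor_ : ∀ {n} → Position n → Player → Set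
p IsWinFor W = Σ (Strategy W (toMove p) (colouring p)) Winning

next : Fin 5 → Fin 5
next x = suc (toℕ x) mod 5

-- The green 5-cycle is v 0, v 1, v 2, v 3, v 4; its complement joins the
-- vertices at cyclic distance two, so together these are all ten edges.
record IsDrawnK5On {n} (v : Fin 5 → Fin n) (d : Colouring n) : Set where
  field
    injective  : Injective _≡_ _≡_ v
    greenCycle : ∀ x → colour d (v x) (v (next x)) ≡ just green
    redCycle   : ∀ x → colour d (v x) (v (next (next x))) ≡ just red

record IsDrawnK5MinusRedEdge {n} (c : Colouring n) : Set where
  field
    vertices  : Fin 5 → Fin n
    drawing   : Colouring n
    drawn     : IsDrawnK5On vertices drawing
    -- By symmetry, this makes every edge not inside the five vertices uncoloured.
    elsewhere : ∀ i j → (∀ x → vertices x ≢ i) → colour drawing i j ≡ nothing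
    removed   : Edge n
    wasRed    : colour drawing (end₁ removed) (end₂ removed) ≡ just red
    remainder : ∀ i j → colour c i j ≡ colour (drawing [ removed ≔ nothing ]) i j

{-# OPTIONS --safe #-}

-- Strategy stealing.  Let d be the drawn K₅.  Every position on at least six
-- vertices is won by one of the players, since a full board contains a
-- monochromatic triangle; consider d with PII to move.
--   * If PII wins it, then PII follows the same strategy with the missing red
--     edge imagined to be red.  PI cannot profit from that edge being free,
--     because colouring it green completes a green triangle.
--   * If PI wins it, then, as x ↦ 2x exchanges the two 5-cycles, PII wins d
--     with PI to move, and so PII wins by colouring the missing edge.
module Submission where

open import Defs
open import Data.Fin using (Fin; zero; suc; toℕ; _≟_; _↑ˡ_)
open import Data.Fin.Patterns
open import Data.Fin.Permutation as Permutation
  using (Permutation′; permutation; _⟨$⟩ʳ_; _⟨$⟩ˡ_; transpose; inverseˡ; inverseʳ)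
open import Data.Fin.Properties using (any?; all?; sequence; suc-injective; ↑ˡ-injective)
open import Data.List using (List; filter; length; allFin; cartesianProduct)
open import Data.List.Membership.Propositional using (_∈_; lose)
open import Data.List.Membership.Propositional.Properties
  using (∈-filter⁺; ∈-cartesianProduct⁺; ∈-allFin)
open import Data.List.Properties using (filter-notAll)
open import Data.Maybe as Maybe using (Maybe; just; nothing)
open import Data.Maybe.Properties as Maybe using (just-injective; map-id)
open import Data.Nat using (ℕ; suc; _≥_; _<_; s≤s; _+_; _*_)
open import Data.Nat.DivMod using (_mod_)
open import Data.Nat.Properties using (≤-trans; n<1+n; m≤n⇒∃[o]m+o≡n)
open import Data.Product using (Σ; ∃-syntax; _×_; _,_; proj₁; proj₂)
open import Data.Sum as Sum using (_⊎_; inj₁; inj₂; [_,_]′)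
import Data.Sum.Effectful.Left as Sumₗ
open import Function using (_∘_; id)
open import Function.Bundles using (module Injection)
open import Function.Definitions using (Injective)
open import Function.Properties.Inverse using (↔⇒↣)
open import Level using (0ℓ)
open import Relation.Binary.PropositionalEquality
  using (_≡_; _≢_; refl; sym; trans; cong; subst)
open import Relation.Nullary using (¬_; Dec; yes; no; contradiction)
open import Relation.Nullary.Decidable
  using (¬?; _×-dec_; _⊎-dec_; dec-true; dec-false; from-yes)

private
  variable
    n : ℕ
    c c′ : Colouring n
    P Q W : Player

-- Colours, players and recoloured edges

other : Colour → Colour
other green = red
other red   = green

other-involutive : ∀ k → other (other k) ≡ k
other-involutive green = refl
other-involutive red   = refl

opponent-involutive : ∀ P → opponent (opponent P) ≡ P
opponent-involutive PI  = refl
opponent-involutive PII = refl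

colourOf-opponent : ∀ P → colourOf (opponent P) ≡ other (colourOf P)
colourOf-opponent PI  = refl
colourOf-opponent PII = refl

colourOf≢opponent : ∀ P → colourOf P ≢ colourOf (opponent P)
colourOf≢opponent PI  ()
colourOf≢opponent PII ()

≢⇒other : ∀ k l → l ≢ k → l ≡ other k
≢⇒other green green l≢k = contradiction refl l≢k
≢⇒other green red   _   = refl
≢⇒other red   green _   = refl
≢⇒other red   red   l≢k = contradiction refl l≢k

≢-both⇒≡ : ∀ {k l m : Colour} → k ≢ m → l ≢ m → k ≡ l
≢-both⇒≡ {k} {l} {m} k≢m l≢m = trans (≢⇒other m k k≢m) (sym (≢⇒other m l l≢m))

eitherColour : ∀ P {T : Colour → Set} →
               T (colourOf P) → T (colourOf (opponent P)) → ∀ k → T k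
eitherColour PI  t u green = t
eitherColour PI  t u red   = u
eitherColour PII t u green = u
eitherColour PII t u red   = t

just≢nothing : ∀ {m : Maybe Colour} {k} → m ≡ just k → m ≢ nothing
just≢nothing refl ()

joined-colour : (c : Colouring n) (e : Edge n) {i j : Fin n} → Joins e i j →
                colour c i j ≡ colour c (end₁ e) (end₂ e)
joined-colour c e (inj₁ (refl , refl)) = refl
joined-colour c e (inj₂ (refl , refl)) = symmetric c (end₂ e) (end₁ e)

update-joined : (c : Colouring n) (e : Edge n) {m : Maybe Colour} {i j : Fin n} →
                Joins e i j → colour (c [ e ≔ m ]) i j ≡ m
update-joined c e {i = i} {j} p rewrite dec-true (joins? e i j) p = refl

update-unjoined : (c : Colouring n) (e : Edge n) {m : Maybe Colour} {i j : Fin n} →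
                  ¬ Joins e i j → colour (c [ e ≔ m ]) i j ≡ colour c i j
update-unjoined c e {i = i} {j} p rewrite dec-false (joins? e i j) p = refl

unjoined : (c : Colouring n) (e : Edge n) {i j : Fin n} →
           colour c i j ≢ colour c (end₁ e) (end₂ e) → ¬ Joins e i j
unjoined c e differ p = differ (joined-colour c e p)

update-keeps : (c : Colouring n) (e : Edge n) {m : Maybe Colour} {i j : Fin n} {k : Colour} →
               colour c (end₁ e) (end₂ e) ≡ nothing → colour c i j ≡ just k →
               colour (c [ e ≔ m ]) i j ≡ just k
update-keeps c e blank eq =
  trans (update-unjoined c e (unjoined c e λ same → just≢nothing eq (trans same blank))) eq

permutation-injective : (π : Permutation′ n) → Injective _≡_ _≡_ (π ⟨$⟩ʳ_)
permutation-injective π = Injection.injective (↔⇒↣ π)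

-- Composing winning strategies

-- Unlike `_IsWinFor_`, this allows any colouring with either player to move. The drawn K₅ with PII
-- to move has five edges of each colour and so is no `Position` with that turn.
Wins : Player → Player → Colouring n → Set
Wins W P c = Σ (Strategy W P c) Winning

beaten : opponent P ≡ W → MonoTriangle (colourOf P) c → Wins W Q c
beaten {P = P} refl t = stop (triangle P t) , λ where stop → refl

-- The next player is given up to an equation because `onPlayers (opponent W)` is only provably the
-- opponent of `onPlayers W` and does not match the index of the constructor.
attack : Q ≡ opponent W → TriangleFree c → (m : Move c) →
         Wins W Q (play W c m) → Wins W W c
attack refl free m (s , win) = choose (free , m) m s , λ where (choose p) → win p

defend : P ≡ opponent W → TriangleFree c → Move c →
         ((m : Move c) → Wins W W (play P c m)) → Wins W P c
defend refl free m f =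
  respond (free , m) (proj₁ ∘ f) , λ where (respond m′ p) → proj₂ (f m′) p

-- Transfer of strategies along symmetries

record Symmetry (n : ℕ) : Set where
  field
    perm         : Permutation′ n
    onColours    : Colour → Colour
    onPlayers    : Player → Player
    involutive   : ∀ k → onColours (onColours k) ≡ k
    compatible   : ∀ P → colourOf (onPlayers P) ≡ onColours (colourOf P)
    preserveTurn : ∀ P → onPlayers (opponent P) ≡ opponent (onPlayers P)

identity : Symmetry n
identity = record
  { perm         = Permutation.id
  ; onColours    = id
  ; onPlayers    = id
  ; involutive   = λ _ → refl
  ; compatible   = λ _ → refl
  ; preserveTurn = λ _ → refl
  }

colourSwap : Permutation′ n → Symmetry n
colourSwap ρ = record
  { perm         = ρ
  ; onColours    = other
  ; onPlayers    = opponent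
  ; involutive   = other-involutive
  ; compatible   = colourOf-opponent
  ; preserveTurn = λ _ → refl
  }

module Simulation {n : ℕ} (σ : Symmetry n) where
  open Symmetry σ

  ρ : Fin n → Fin n
  ρ = perm ⟨$⟩ʳ_

  ρ⁻¹ : Fin n → Fin n
  ρ⁻¹ = perm ⟨$⟩ˡ_

  ρ-injective : Injective _≡_ _≡_ ρ
  ρ-injective = permutation-injective perm

  Same : Colouring n → Colouring n → Fin n → Fin n → Set
  Same c c′ i j = colour c′ i j ≡ Maybe.map onColours (colour c (ρ i) (ρ j))

  -- An edge that is free in c′ although W has it in c; it is harmless since
  -- W's opponent would lose by taking it.
  Reserved : Player → Colouring n → Colouring n → Fin n → Fin n → Set
  Reserved W c c′ i j =
    colour c (ρ i) (ρ j) ≡ just (colourOf W) × colour c′ i j ≡ nothing ×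
    ∃[ z ] (colour c′ i z ≡ just rival × colour c′ z j ≡ just rival)
    where
    rival : Colour
    rival = colourOf (onPlayers (opponent W))

  -- The game is played on `c′`, and `ρ` leads from there to `c`, where a strategy is known.
  -- Wrapping the relation in a record lets `W`, `c` and `c′` be inferred.
  record Simulates (W : Player) (c c′ : Colouring n) : Set where
    constructor simulates
    field
      at : ∀ i j → Same c c′ i j ⊎ Reserved W c c′ i j

  open Simulates

  map-just⁻ : ∀ {x : Maybe Colour} {k} →
              just k ≡ Maybe.map onColours x → x ≡ just (onColours k)
  map-just⁻ {just l} refl = cong just (sym (involutive l))

  map-nothing⁻ : ∀ {x : Maybe Colour} → nothing ≡ Maybe.map onColours x → x ≡ nothing
  map-nothing⁻ {nothing} _ = refl

  coloured⁻ : Simulates W c c′ → ∀ {i j k} → colour c′ i j ≡ just k →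
              colour c (ρ i) (ρ j) ≡ just (onColours k)
  coloured⁻ sim {i} {j} eq with at sim i j
  ... | inj₁ same            = map-just⁻ (trans (sym eq) same)
  ... | inj₂ (_ , blank , _) = contradiction blank (just≢nothing eq)

  -- Reserved edges are blank in `c′`, so all sides of a triangle there pull back to `c`.
  triangleFree⁺ : Simulates W c c′ → TriangleFree c → TriangleFree c′
  triangleFree⁺ {c = c} {c′} sim free k (x , y , z , xy , yz , xz) =
    free (onColours k) (ρ x , ρ y , ρ z , back xy , back yz , back xz)
    where
    back : ∀ {i j} → colour c′ i j ≡ just k → colour c (ρ i) (ρ j) ≡ just (onColours k)
    back = coloured⁻ sim

  -- Here `P` is the rival of the player for whom edges are reserved. Reserved edges have the other
  -- colour in `c`, so no side of the triangle of `P` is missing from `c′`.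
  triangle⁺ : Simulates (opponent P) c c′ → MonoTriangle (colourOf P) c →
              MonoTriangle (colourOf (onPlayers P)) c′
  triangle⁺ {P} {c} {c′} sim (x , y , z , xy , yz , xz) =
    ρ⁻¹ x , ρ⁻¹ y , ρ⁻¹ z , forth xy , forth yz , forth xz
    where
    forth : ∀ {i j} → colour c i j ≡ just (colourOf P) →
            colour c′ (ρ⁻¹ i) (ρ⁻¹ j) ≡ just (colourOf (onPlayers P))
    forth {i} {j} eq with at sim (ρ⁻¹ i) (ρ⁻¹ j)
    ... | inj₁ same rewrite inverseʳ perm {i} | inverseʳ perm {j} | eq =
      trans same (cong just (sym (compatible P)))
    ... | inj₂ (own , _) rewrite inverseʳ perm {i} | inverseʳ perm {j} =
      contradiction (just-injective (trans (sym eq) own)) (colourOf≢opponent P)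

  -- Moves never overwrite a coloured edge, so the two rival edges guarding a reserved edge persist.
  -- The edges just coloured correspond outright.
  simulates-update : ∀ {e e′ k k′} → Simulates W c c′ →
    colour c (end₁ e) (end₂ e) ≡ nothing → colour c′ (end₁ e′) (end₂ e′) ≡ nothing →
    ρ (end₁ e′) ≡ end₁ e → ρ (end₂ e′) ≡ end₂ e → k′ ≡ onColours k →
    Simulates W (c [ e ≔ just k ]) (c′ [ e′ ≔ just k′ ])
  simulates-update {W = W} {c} {c′} {e} {e′} {k} sim blank blank′ refl refl refl =
    simulates related
    where
    c⁺ c′⁺ : Colouring n
    c⁺  = c [ e ≔ just k ]
    c′⁺ = c′ [ e′ ≔ just (onColours k) ]

    forth : ∀ {i j} → Joins e′ i j → Joins e (ρ i) (ρ j)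
    forth (inj₁ (refl , refl)) = inj₁ (refl , refl)
    forth (inj₂ (refl , refl)) = inj₂ (refl , refl)

    back : ∀ {i j} → Joins e (ρ i) (ρ j) → Joins e′ i j
    back (inj₁ (p , q)) = inj₁ (ρ-injective p , ρ-injective q)
    back (inj₂ (p , q)) = inj₂ (ρ-injective p , ρ-injective q)

    related : ∀ i j → Same c⁺ c′⁺ i j ⊎ Reserved W c⁺ c′⁺ i j
    related i j with joins? e′ i j
    ... | yes p = inj₁ (trans (update-joined c′ e′ p)
      (sym (cong (Maybe.map onColours) (update-joined c e (forth p)))))
    ... | no ¬p = Sum.map
      (λ same → trans still′ (trans same (cong (Maybe.map onColours) (sym still))))
      (λ (own , free , z , iz , zj) →
        trans still own , trans still′ free , z ,
        update-keeps c′ e′ blank′ iz , update-keeps c′ e′ blank′ zj)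
      (at sim i j)
      where
      still : colour c⁺ (ρ i) (ρ j) ≡ colour c (ρ i) (ρ j)
      still = update-unjoined c e (¬p ∘ back)
      still′ : colour c′⁺ i j ≡ colour c′ i j
      still′ = update-unjoined c′ e′ ¬p

  move⁺ : Simulates W c c′ → (m : Move c) →
          Σ (Move c′) λ (e′ , _) → ρ (end₁ e′) ≡ end₁ (proj₁ m) × ρ (end₂ e′) ≡ end₂ (proj₁ m)
  move⁺ {W} {c} {c′} sim (edge a b a≢b , blank) =
    (edge (ρ⁻¹ a) (ρ⁻¹ b) distinct′ , blank′) , inverseʳ perm , inverseʳ perm
    where
    distinct′ : ρ⁻¹ a ≢ ρ⁻¹ b
    distinct′ eq = a≢b (trans (sym (inverseʳ perm)) (trans (cong ρ eq) (inverseʳ perm)))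
    blank′ : colour c′ (ρ⁻¹ a) (ρ⁻¹ b) ≡ nothing
    blank′ with at sim (ρ⁻¹ a) (ρ⁻¹ b)
    ... | inj₁ same rewrite inverseʳ perm {a} | inverseʳ perm {b} | blank = same
    ... | inj₂ (_ , free , _) = free

  -- Induction on the strategy. The winner's moves are carried over by `move⁺`; a rival's move is
  -- pulled back along `ρ` and answered by `s`, unless it takes a reserved edge, which loses at
  -- once.
  simulate : (s : Strategy W P c) → Winning s → Simulates W c c′ →
             Wins (onPlayers W) (onPlayers P) c′
  -- `win stop` shows that `W` is the opponent of `P`, so this triangle is the rival's and survives
  -- in `c′`.
  simulate (stop (triangle P t)) win sim with win stop
  ... | refl = beaten (sym (preserveTurn P)) (triangle⁺ sim t)
  simulate (stop (full _ _)) win sim with win stop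
  ... | ()
  simulate {W} (choose (free , _) m s) win sim =
    let m′ , p , q = move⁺ sim m in
    attack (preserveTurn W) (triangleFree⁺ sim free) m′
      (simulate s (win ∘ choose)
        (simulates-update sim (proj₂ m) (proj₂ m′) p q (compatible W)))
  simulate {W} {c = c} {c′ = c′} (respond (free , m) s) win sim =
    defend (preserveTurn W) (triangleFree⁺ sim free) (proj₁ (move⁺ sim m)) answer
    where
    answer : (m′ : Move c′) →
             Wins (onPlayers W) (onPlayers W) (play (onPlayers (opponent W)) c′ m′)
    answer (edge a b a≢b , blank′) with at sim a b
    ... | inj₁ same = simulate (s m₀) (win ∘ respond m₀)
      (simulates-update {e = proj₁ m₀} {e′ = edge a b a≢b} sim (proj₂ m₀) blank′
        refl refl (compatible (opponent W)))
      where
      m₀ : Move c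
      m₀ = edge (ρ a) (ρ b) (a≢b ∘ ρ-injective) , map-nothing⁻ (trans (sym blank′) same)
    -- The rival has coloured the edge from `a` to `b`, closing a triangle with the two guards at
    -- `z`.
    ... | inj₂ (_ , _ , z , az , zb) =
      beaten (trans (sym (preserveTurn (opponent W))) (cong onPlayers (opponent-involutive W)))
        ( a , z , b
        , update-keeps c′ (edge a b a≢b) blank′ az
        , update-keeps c′ (edge a b a≢b) blank′ zb
        , update-joined c′ (edge a b a≢b) (inj₁ (refl , refl)))

  simulateWin : Simulates W c c′ → Wins W P c → Wins (onPlayers W) (onPlayers P) c′
  simulateWin sim (s , win) = simulate s win sim

-- Pointwise equal colourings need not be equal records, so the win is transported by simulation
-- instead of `subst`.
Wins-resp : (∀ i j → colour c′ i j ≡ colour c i j) → Wins W P c → Wins W P c′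
Wins-resp {c = c} same =
  simulateWin (simulates λ i j → inj₁ (trans (same i j) (sym (map-id (colour c i j)))))
  where open Simulation identity

-- Ramsey's theorem on six vertices

-- If two of five things had the same colour, then the other three would all
-- have the opposite one.  So any two, in particular any two of the first
-- three, would differ in colour.
three-alike : (f : Fin 5 → Colour) →
  ¬ (∀ {i j k} → i ≢ j → j ≢ k → i ≢ k → f i ≡ f j → f j ≢ f k)
three-alike f apart =
  -- The three permutations yield `f 0F ≢ f 2F`, `f 0F ≢ f 1F` and `f 2F ≢ f 1F`; the last two force
  -- `f 0F ≡ f 2F`.
  differ (transpose 1F 2F) (≢-both⇒≡ (differ Permutation.id) (differ (transpose 0F 2F)))
  where
  differ : (π : Permutation′ 5) → f (π ⟨$⟩ʳ 0F) ≢ f (π ⟨$⟩ʳ 1F)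
  differ π eq =
    apart (move {2F} {3F} λ ()) (move {3F} {4F} λ ()) (move {2F} {4F} λ ())
      (≢-both⇒≡ (rest {2F} (λ ()) (λ ())) (rest {3F} (λ ()) (λ ())))
      (≢-both⇒≡ (rest {3F} (λ ()) (λ ())) (rest {4F} (λ ()) (λ ())))
    where
    move : ∀ {i j} → i ≢ j → π ⟨$⟩ʳ i ≢ π ⟨$⟩ʳ j
    move i≢j = i≢j ∘ permutation-injective π
    rest : ∀ {i} → 1F ≢ i → 0F ≢ i → f (π ⟨$⟩ʳ i) ≢ f (π ⟨$⟩ʳ 1F)
    rest 1≢i 0≢i eq′ = apart (move {0F} {1F} λ ()) (move 1≢i) (move 0≢i) eq (sym eq′)

-- This is R(3,3) ≤ 6. Three of the five spokes at `zero` share a colour; the rim edges between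
-- their ends must avoid it and so form a triangle in the other colour.
ramsey : n ≥ 6 → (c : Colouring n) → TriangleFree c →
         ¬ (∀ i j → i ≢ j → colour c i j ≢ nothing)
ramsey n≥6 c free complete with m≤n⇒∃[o]m+o≡n n≥6
... | m , refl = three-alike (proj₁ ∘ spoke) apart
  where
  v : Fin 5 → Fin (6 + m)
  v x = suc (x ↑ˡ m)

  coloured : ∀ i j → i ≢ j → ∃[ k ] colour c i j ≡ just k
  coloured i j i≢j with colour c i j in eq
  ... | just k  = k , refl
  ... | nothing = contradiction eq (complete i j i≢j)

  spoke : ∀ x → ∃[ k ] colour c zero (v x) ≡ just k
  spoke x = coloured zero (v x) λ ()

  rim : ∀ {x y} → x ≢ y → proj₁ (spoke x) ≡ proj₁ (spoke y) →
        colour c (v x) (v y) ≡ just (other (proj₁ (spoke x)))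
  rim {x} {y} x≢y same =
    let l , eq = coloured (v x) (v y) (x≢y ∘ ↑ˡ-injective m x y ∘ suc-injective)
        k , 0x = spoke x
        l≢k    = λ l≡k → free k
          ( zero , v x , v y , 0x , trans eq (cong just l≡k)
          , trans (proj₂ (spoke y)) (cong just (sym same)))
    in trans eq (cong just (≢⇒other k l l≢k))

  apart : ∀ {x y z} → x ≢ y → y ≢ z → x ≢ z →
          proj₁ (spoke x) ≡ proj₁ (spoke y) → proj₁ (spoke y) ≢ proj₁ (spoke z)
  apart {x} {y} {z} x≢y y≢z x≢z xy yz = free (other (proj₁ (spoke x)))
    ( v x , v y , v z , rim x≢y xy
    , trans (rim y≢z yz) (cong (just ∘ other) (sym xy))
    , rim x≢z (trans xy yz))

-- Determinacy by backward induction

monoTriangle? : ∀ k (c : Colouring n) → Dec (MonoTriangle k c)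
monoTriangle? k c = any? λ x → any? λ y → any? λ z → is x y ×-dec is y z ×-dec is x z
  where
  is : ∀ i j → Dec (colour c i j ≡ just k)
  is i j = Maybe.≡-dec _≟ᶜ_ (colour c i j) (just k)

-- A failed `A i` has to supply the data `B i`, here a strategy, which deciding `A i` would not
-- give.
search : {A B : Fin n → Set} → (∀ i → A i ⊎ B i) → (∃[ i ] A i) ⊎ (∀ i → B i)
search {A = A} f = sequence (Sumₗ.applicative (∃[ i ] A i) 0ℓ) λ i → Sum.map₁ (i ,_) (f i)

blank? : (c : Colouring n) (ij : Fin n × Fin n) → Dec (colour c (proj₁ ij) (proj₂ ij) ≡ nothing)
blank? c (i , j) = Maybe.≡-dec _≟ᶜ_ (colour c i j) nothing

freeMove : n ≥ 6 → (c : Colouring n) → TriangleFree c → Move c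
freeMove n≥6 c free
  with any? (λ i → any? λ j → ¬? (i ≟ j) ×-dec blank? c (i , j))
... | yes (i , j , i≢j , blank) = edge i j i≢j , blank
... | no ¬m = contradiction (λ i j i≢j blank → ¬m (i , j , i≢j , blank)) (ramsey n≥6 c free)

-- Zermelo's argument: either some move wins, or the opponent has a win after every move; `freeMove`
-- excludes draws. The recursion is measured by a list containing all blank pairs, from which each
-- move deletes at least its own.
determined : n ≥ 6 → ∀ P (c : Colouring n) → Wins P P c ⊎ Wins (opponent P) P c
-- The strict bound keeps the fuel positive, so `go` has no clause for zero.
determined {n} n≥6 P c = go (suc (length everything)) P c everything
  (λ i j _ → ∈-cartesianProduct⁺ (∈-allFin i) (∈-allFin j)) (n<1+n _)
  where
  everything : List (Fin n × Fin n)
  everything = cartesianProduct (allFin n) (allFin n)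

  Covers : List (Fin n × Fin n) → Colouring n → Set
  Covers L c = ∀ i j → colour c i j ≡ nothing → (i , j) ∈ L

  go : ∀ fuel P (c : Colouring n) L → Covers L c → length L < fuel →
       Wins P P c ⊎ Wins (opponent P) P c
  go (suc fuel) P c L covers (s≤s L≤fuel)
    with monoTriangle? (colourOf P) c | monoTriangle? (colourOf (opponent P)) c
  ... | yes t | _     = inj₂ (beaten refl t)
  ... | no _  | yes t = inj₁ (beaten (opponent-involutive P) t)
  ... | no ¬t | no ¬u = Sum.map
      (λ (i , j , i≢j , blank , w) → attack refl free (edge i j i≢j , blank) w)
      (λ lost → defend (sym (opponent-involutive P)) free (freeMove n≥6 c free)
        λ (e , blank) → lost (end₁ e) (end₂ e) (distinct e) blank)
      (search λ i → search λ j → try i j)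
    where
    free : TriangleFree c
    free = eitherColour P {λ k → ¬ MonoTriangle k c} ¬t ¬u

    Good Bad : Fin n → Fin n → Set
    Good i j = ∃[ i≢j ] ∃[ blank ] Wins P (opponent P) (play P c (edge i j i≢j , blank))
    Bad i j = ∀ i≢j blank → Wins (opponent P) (opponent P) (play P c (edge i j i≢j , blank))

    try : ∀ i j → Good i j ⊎ Bad i j
    try i j with i ≟ j | blank? c (i , j)
    ... | yes i≡j | _         = inj₂ λ i≢j → contradiction i≡j i≢j
    ... | no _    | no ¬blank = inj₂ λ _ blank → contradiction blank ¬blank
    ... | no i≢j  | yes blank = Sum.swap (Sum.map
      -- `Bad` ranges over all proofs of `i ≢ j`, while `w` concerns the edge built from one of
      -- them; their colours agree definitionally.
      (λ w _ _ → Wins-resp (λ _ _ → refl) w)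
      (λ w → i≢j , blank , subst (λ W → Wins W (opponent P) c⁺) (opponent-involutive P) w)
      (go fuel (opponent P) c⁺ (filter (blank? c⁺) L) covers⁺ (≤-trans shorter L≤fuel)))
      where
      e : Edge n
      e = edge i j i≢j

      c⁺ : Colouring n
      c⁺ = play P c (e , blank)

      shorter : length (filter (blank? c⁺) L) < length L
      shorter = filter-notAll (blank? c⁺) L (lose (covers i j blank)
        (just≢nothing (update-joined c e (inj₁ (refl , refl)))))

      covers⁺ : Covers (filter (blank? c⁺) L) c⁺
      covers⁺ x y blank⁺ = ∈-filter⁺ (blank? c⁺) (covers x y (blank⁻ (colour c x y) refl)) blank⁺
        where
        blank⁻ : ∀ m → colour c x y ≡ m → colour c x y ≡ nothing
        blank⁻ nothing  eq = eq
        blank⁻ (just _) eq = contradiction blank⁺ (just≢nothing (update-keeps c e blank eq))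

-- The doubling symmetry of the drawn K₅

-- Calling the five vertices by their places on the green cycle, doubling
-- exchanges green and red.
double halve : Fin 5 → Fin 5
double x = (2 * toℕ x) mod 5
halve  x = (3 * toℕ x) mod 5

double-halve : ∀ x → double (halve x) ≡ x
double-halve = from-yes (all? λ x → double (halve x) ≟ x)

halve-double : ∀ x → halve (double x) ≡ x
halve-double = from-yes (all? λ x → halve (double x) ≟ x)

double-next : ∀ x → double (next x) ≡ next (next (double x))
double-next = from-yes (all? λ x → double (next x) ≟ next (next (double x)))

-- Modulo 5, 2(x + 2) + 1 = 2x: doubling turns a red edge into a green one traversed backwards.
next-double-next² : ∀ x → next (double (next (next x))) ≡ double x
next-double-next² = from-yes (all? λ x → next (double (next (next x))) ≟ double x)

AtMostTwoSteps : Fin 5 → Fin 5 → Set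
AtMostTwoSteps x y = y ≡ x ⊎ y ≡ next x ⊎ y ≡ next (next x)

-- Up to the order of the ends, this reduces all 25 pairs to a loop, a green edge and a red edge.
atMostTwoSteps : ∀ x y → AtMostTwoSteps x y ⊎ AtMostTwoSteps y x
atMostTwoSteps = from-yes (all? λ x → all? λ y → steps? x y ⊎-dec steps? y x)
  where
  steps? : ∀ x y → Dec (AtMostTwoSteps x y)
  steps? x y = (y ≟ x) ⊎-dec (y ≟ next x) ⊎-dec (y ≟ next (next x))

module DrawnK5 {v : Fin 5 → Fin n} {d : Colouring n} (drawn : IsDrawnK5On v d)
  (elsewhere : ∀ i j → (∀ x → v x ≢ i) → colour d i j ≡ nothing) where
  open IsDrawnK5On drawn

  data Locate : Fin n → Set where
    inside  : ∀ x → Locate (v x)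
    outside : ∀ {i} → (∀ x → v x ≢ i) → Locate i

  locate : ∀ i → Locate i
  locate i with any? (λ x → v x ≟ i)
  ... | yes (x , refl) = inside x
  ... | no ¬x          = outside λ x eq → ¬x (x , eq)

  extend : (Fin 5 → Fin 5) → Fin n → Fin n
  extend f i with locate i
  ... | inside x  = v (f x)
  ... | outside _ = i

  extend-inside : ∀ f {i} x → v x ≡ i → extend f i ≡ v (f x)
  extend-inside f {i} x eq with locate i
  ... | inside y    = cong (v ∘ f) (injective (sym eq))
  ... | outside out = contradiction eq (out x)

  extend-outside : ∀ f {i} → (∀ x → v x ≢ i) → extend f i ≡ i
  extend-outside f {i} out with locate i
  ... | inside x  = contradiction refl (out x)
  ... | outside _ = refl

  extend-inverse : ∀ f g → (∀ x → f (g x) ≡ x) → ∀ i → extend f (extend g i) ≡ i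
  extend-inverse f g inv i with locate i
  ... | inside x    = trans (extend-inside f (g x) refl) (cong v (inv x))
  ... | outside out = extend-outside f out

  doubling : Permutation′ n
  doubling = permutation (extend double) (extend halve)
    (extend-inverse double halve double-halve) (extend-inverse halve double halve-double)

  swaps-steps : ∀ x y → AtMostTwoSteps x y →
    colour d (v x) (v y) ≡ Maybe.map other (colour d (v (double x)) (v (double y)))
  swaps-steps x _ (inj₁ refl)
    rewrite loopless d (v x) | loopless d (v (double x)) = refl
  swaps-steps x _ (inj₂ (inj₁ refl))
    rewrite greenCycle x | double-next x | redCycle (double x) = refl
  swaps-steps x _ (inj₂ (inj₂ refl))
    rewrite redCycle x | sym (next-double-next² x)
          | symmetric d (v (next (double (next (next x))))) (v (double (next (next x))))
          | greenCycle (double (next (next x))) = refl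

  -- `extend double` keeps inside vertices inside and fixes the outside ones, so an edge leaving the
  -- five vertices and its image are both blank. Pairs inside fall under `swaps-steps`.
  swaps : ∀ i j →
    colour d i j ≡ Maybe.map other (colour d (extend double i) (extend double j))
  swaps i j with locate i | locate j
  ... | outside out | _           =
    trans (elsewhere i j out) (sym (cong (Maybe.map other) (elsewhere i _ out)))
  ... | inside x    | outside out
    rewrite symmetric d (v x) j | elsewhere j (v x) out
          | symmetric d (v (double x)) j | elsewhere j (v (double x)) out = refl
  ... | inside x    | inside y with atMostTwoSteps x y
  ...   | inj₁ steps = swaps-steps x y steps
  ...   | inj₂ steps = trans (symmetric d (v x) (v y)) (trans (swaps-steps y x steps)
    (cong (Maybe.map other) (symmetric d (v (double y)) (v (double x)))))

  -- A red edge joins places two steps apart, and the place between them is its green apex. These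
  -- green edges become the guards that deter PI from the missing edge.
  apex-steps : ∀ x y → AtMostTwoSteps x y → colour d (v x) (v y) ≡ just red →
    ∃[ z ] (colour d (v x) z ≡ just green × colour d z (v y) ≡ just green)
  apex-steps x _ (inj₁ refl)        isRed = contradiction (loopless d (v x)) (just≢nothing isRed)
  apex-steps x _ (inj₂ (inj₁ refl)) isRed =
    contradiction (trans (sym (greenCycle x)) isRed) λ ()
  apex-steps x _ (inj₂ (inj₂ refl)) _     = v (next x) , greenCycle x , greenCycle (next x)

  apex : ∀ i j → colour d i j ≡ just red →
         ∃[ z ] (colour d i z ≡ just green × colour d z j ≡ just green)
  apex i j isRed with locate i | locate j
  ... | outside out | _           = contradiction (elsewhere i j out) (just≢nothing isRed)
  ... | inside x    | outside out =
    contradiction (trans (symmetric d (v x) j) (elsewhere j (v x) out)) (just≢nothing isRed)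
  ... | inside x    | inside y with atMostTwoSteps x y
  ...   | inj₁ steps = apex-steps x y steps isRed
  ...   | inj₂ steps =
    let z , yz , zx = apex-steps y x steps (trans (symmetric d (v y) (v x)) isRed)
    in z , trans (symmetric d (v x) z) zx , trans (symmetric d z (v y)) yz

  exchange : Wins PI PII d → Wins PII PI d
  exchange = simulateWin (simulates λ i j → inj₁ (swaps i j))
    where open Simulation (colourSwap doubling)

-- Stealing the strategy from the full drawing

theorem2 : ∀ (n : ℕ) → n ≥ 6 → (p : Position n) →
    IsDrawnK5MinusRedEdge (colouring p) →
    toMove p ≡ PII →
    p IsWinFor PII
theorem2 n n≥6 p isK5 toMove≡PII =
  subst (λ P → Wins PII P board) (sym toMove≡PII)
    ([ steal , complete ∘ exchange ]′ (determined n≥6 PII drawing))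
  where
  open IsDrawnK5MinusRedEdge isK5 renaming (removed to e)
  open DrawnK5 drawn elsewhere

  board : Colouring n
  board = colouring p

  stillGreen : ∀ {i j} → colour drawing i j ≡ just green → colour board i j ≡ just green
  stillGreen {i} {j} isGreen = trans (remainder i j) (trans
    (update-unjoined drawing e (unjoined drawing e λ same →
      contradiction (trans (sym isGreen) (trans same wasRed)) λ ()))
    isGreen)

  steal : Wins PII PII drawing → Wins PII PII board
  steal = simulateWin (simulates at-edge)
    where
    open Simulation identity

    at-edge : ∀ i j → Same drawing board i j ⊎ Reserved PII drawing board i j
    at-edge i j with joins? e i j
    ... | no ¬p = inj₁ (trans (remainder i j)
      (trans (update-unjoined drawing e ¬p) (sym (map-id (colour drawing i j)))))
    -- The missing edge is the reserved one: red in `drawing`, blank on the board, with both green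
    -- sides at its apex still present.
    ... | yes p =
      let isRed = trans (joined-colour drawing e p) wasRed
          z , iz , zj = apex i j isRed
      in inj₂ ( isRed , trans (remainder i j) (update-joined drawing e p)
              , z , stillGreen iz , stillGreen zj)

  lastRed : Move board
  lastRed = e , trans (remainder (end₁ e) (end₂ e)) (update-joined drawing e (inj₁ (refl , refl)))

  restored : ∀ i j → colour (play PII board lastRed) i j ≡ colour drawing i j
  restored i j with joins? e i j
  ... | yes p = trans (update-joined board e p) (sym (trans (joined-colour drawing e p) wasRed))
  ... | no ¬p =
    trans (update-unjoined board e ¬p) (trans (remainder i j) (update-unjoined drawing e ¬p))

  complete : Wins PII PI drawing → Wins PII PII board
  -- Colouring the missing edge red gives back `drawing` only pointwise, with PI now to move.
  complete w = attack refl (triangleFree p) lastRed (Wins-resp restored w)
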